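{- Let $\ell\ge 1$ and $r\ge 0$. There is a bijection $\Phi$ from the set $\mathcal A_{\ell,r}$ of sequences $\mathbf a=(a_1,\ldots,a_\ell)$ of nonnegative integers with $\operatorname{exc}(\mathbf a)=r$ to the set $\mathcal D_{\ell,r}$ of labeled Dyck paths of semilength $\ell$ with total label sum $r$, such that, whenever $\mathbf a\in\mathcal A_{\ell,r}$ and $(\pi,\lambda)=\Phi(\mathbf a)$, \[ \operatorname{asc}(\mathbf a)=\operatorname{pk}(\pi)-1,\qquad \operatorname{lev}(\mathbf a)=\operatorname{lv}(\pi,\lambda),\qquad \operatorname{rlmin}(\mathbf a)=\operatorname{ret}(\pi), \] and moreover the label of the initial up step of $\pi$ is $\min\{a_1,\ldots,a_\ell\}$. Consequently, \[ |\mathcal A_{\ell,r}|=C_\ell\binom{r+\ell-1}{\ell-1}, \] where $C_\ell=\frac1{\ell+1}\binom{2\ell}{\ell}$ is the Catalan number.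
   Context: Write $(n)_+=\max\{n,0\}$. For a sequence $\mathbf a=(a_1,\ldots,a_\ell)$ of nonnegative integers: $\operatorname{exc}(\mathbf a)=a_1+\sum_{j=2}^{\ell}(a_j-a_{j-1}-1)_+$; $\operatorname{asc}(\mathbf a)=|\{j:1\le j<\ell,\ a_j<a_{j+1}\}|$; $\operatorname{lev}(\mathbf a)=|\{j:1\le j<\ell,\ a_j=a_{j+1}\}|$; $\operatorname{rlmin}(\mathbf a)$ is the number of strict right-to-left minima, i.e. of indices $i$ with $a_i<a_j$ for all $j>i$. A Dyck path of semilength $\ell$ is a lattice path from $(0,0)$ to $(2\ell,0)$ with steps $U=(1,1)$, $D=(1,-1)$ that never goes below the horizontal axis; $\epsilon$ is the empty path. $\operatorname{pk}(\pi)$ is the number of peaks (consecutive steps $UD$), and $\operatorname{ret}(\pi)$ is the number of returns (down steps ending on the horizontal axis). A nonempty Dyck path is primitive if it has exactly one return. A labeled Dyck path is a pair $(\pi,\lambda)$ with $\pi$ a Dyck path of semilength $\ell$ and $\lambda=(\lambda_1,\ldots,\lambda_\ell)$ a sequence of nonnegative integers, $\lambda_i$ being the label of the $i$th up step from left to right; its total label sum is $|\lambda|=\lambda_1+\cdots+\lambda_\ell$. The statistic $\operatorname{lv}$ is defined recursively: $\operatorname{lv}=0$ on the empty path; for a nonempty labeled path with first-return decomposition $\pi=U\pi_LD\pi_R$ ($\pi_L,\pi_R$ Dyck paths) and induced labelings $\lambda_L,\lambda_R$, one has $\operatorname{lv}(\pi,\lambda)=\operatorname{lv}(\pi_L,\lambda_L)+\operatorname{lv}(\pi_R,\lambda_R)+\delta(\pi_L,\lambda_L)$,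 where $\delta(\pi_L,\lambda_L)=1$ if $\pi_L$ is nonempty and primitive and its initial up step has label $0$, and $\delta(\pi_L,\lambda_L)=0$ otherwise. (Equivalently, $\operatorname{lv}(\pi,\lambda)$ is the number of factors $UU\sigma DD$ of $\pi$, with $\sigma$ a possibly empty Dyck path, whose second up step is labeled $0$.) -}

module Defs where

open import Data.Bool using (if_then_else_; _∧_)
open import Data.List using (List; []; _∷_; _++_; length)
open import Data.List.Properties using (++-assoc; length-++)
open import Data.Nat using (ℕ; zero; suc; _+_; _*_; _∸_; _/_; _⊓_; _≡ᵇ_; _<ᵇ_; s≤s; z≤n)
open import Data.Nat.Combinatorics using (_C_; nCk+nC[k+1]≡[n+1]C[k+1]; nC1≡n; k>n⇒nCk≡0)
open import Data.Nat.Divisibility using (divides; ∣m+n∣m⇒∣n)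
open import Data.Nat.DivMod using (m/n*n≡m)
open import Data.Nat.Properties using (*-cancelˡ-≡; *-comm; *-zeroʳ; _<?_)
open import Data.Nat.Tactic.RingSolver using (solve-∀)
open import Data.Product using (Σ; ∃; _,_)
open import Data.Vec using (Vec; []; _∷_; take; drop; sum; foldr₁)
open import Data.Vec.Relation.Unary.All using (all?)
open import Relation.Binary.PropositionalEquality using (_≡_; refl; sym; trans; cong; cong₂; subst; module ≡-Reasoning)
open import Relation.Nullary using (does)

private
  variable
    h m n : ℕ

-- Truncated subtraction gives y ∸ x ∸ 1 = (y - x - 1)₊.
jumps : Vec ℕ n → ℕ
jumps []           = 0
jumps (_ ∷ [])     = 0
jumps (x ∷ y ∷ as) = (y ∸ x ∸ 1) + jumps (y ∷ as)

exc : Vec ℕ n → ℕ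
exc []       = 0
exc (x ∷ as) = x + jumps (x ∷ as)

asc : Vec ℕ n → ℕ
asc []           = 0
asc (_ ∷ [])     = 0
asc (x ∷ y ∷ as) = (if x <ᵇ y then 1 else 0) + asc (y ∷ as)

lev : Vec ℕ n → ℕ
lev []           = 0
lev (_ ∷ [])     = 0
lev (x ∷ y ∷ as) = (if x ≡ᵇ y then 1 else 0) + lev (y ∷ as)

rlmin : Vec ℕ n → ℕ
rlmin []       = 0
rlmin (x ∷ as) = (if does (all? (x <?_) as) then 1 else 0) + rlmin as

minimum : Vec ℕ (suc n) → ℕ
minimum = foldr₁ _⊓_

𝒜 : ℕ → ℕ → Set
𝒜 ℓ r = Σ (Vec ℕ ℓ) λ a → exc a ≡ r

data Step : Set where
  U D : Step

private
  variable
    w π πL πR : List Step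

-- Walk h w: the path w, started at height h, ends at height 0. Heights are
-- natural numbers, so the path never goes below the axis.
data Walk : ℕ → List Step → Set where
  []  : Walk 0 []
  U∷_ : Walk (suc h) w → Walk h (U ∷ w)
  D∷_ : Walk h w → Walk (suc h) (D ∷ w)

record IsDyck (ℓ : ℕ) (π : List Step) : Set where
  constructor isDyck
  field
    walk : Walk 0 π
    len  : length π ≡ 2 * ℓ

pk : List Step → ℕ
pk []          = 0
pk (U ∷ D ∷ w) = suc (pk w)
pk (_ ∷ w)     = pk w

-- The first argument is the current height. The clause for a down step at
-- height 0 is never reached from a Dyck path.
retFrom : ℕ → List Step → ℕ
retFrom h             []      = 0
retFrom h             (U ∷ w) = retFrom (suc h) w
retFrom 0             (D ∷ w) = retFrom 0 w
retFrom 1             (D ∷ w) = suc (retFrom 0 w)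
retFrom (suc (suc h)) (D ∷ w) = retFrom (suc h) w

ret : List Step → ℕ
ret = retFrom 0

-- The (unique) iterated first-return decomposition of a Dyck path; the number
-- is the semilength.
data Decomp : List Step → ℕ → Set where
  ε    : Decomp [] 0
  node : Decomp πL m → Decomp πR n → Decomp (U ∷ πL ++ D ∷ πR) (suc (m + n))

-- A walk from height h to 0 is a sequence of h + 1 Dyck paths separated by
-- down steps.
data Pieces : ℕ → List Step → Set where
  last : Decomp π n → Pieces 0 π
  cons : Decomp π n → Pieces h w → Pieces (suc h) (π ++ D ∷ w)

up : Pieces (suc h) w → Pieces h (U ∷ w)
up (cons L (last R)) = last (node L R)
up (cons {π = πL} L (cons {π = πR} {w = w} R ps)) =
  subst (Pieces _) (cong (U ∷_) (++-assoc πL (D ∷ πR) (D ∷ w))) (cons (node L R) ps)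

pieces : Walk h w → Pieces h w
pieces []     = last ε
pieces (U∷ p) = up (pieces p)
pieces (D∷ p) = cons ε (pieces p)

walkDecomp : Walk 0 π → ∃ (Decomp π)
walkDecomp p with pieces p
... | last t = _ , t

decompLength : Decomp π n → length π ≡ 2 * n
decompLength ε = refl
decompLength (node {πL = πL} {m = m} {πR = πR} {n = n} L R)
  rewrite length-++ πL {D ∷ πR} | decompLength L | decompLength R = lemma m n
  where
  lemma : ∀ m n → suc (2 * m + suc (2 * n)) ≡ 2 * suc (m + n)
  lemma = solve-∀

decompose : IsDyck n π → Decomp π n
decompose {n} {π} (isDyck p len) with walkDecomp p
... | k , t = subst (Decomp π) (*-cancelˡ-≡ k n 2 (trans (sym (decompLength t)) len)) t

δ : List Step → Vec ℕ n → ℕ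
δ π []          = 0
δ π (label ∷ _) = if (ret π ≡ᵇ 1) ∧ (label ≡ᵇ 0) then 1 else 0

lvDecomp : Decomp π n → Vec ℕ n → ℕ
lvDecomp ε [] = 0
lvDecomp (node {πL = πL} {m = m} L R) (_ ∷ labels) =
  lvDecomp L (take m labels) + lvDecomp R (drop m labels) + δ πL (take m labels)

record 𝒟 (ℓ r : ℕ) : Set where
  constructor mk𝒟
  field
    path     : List Step
    dyck     : IsDyck ℓ path
    labels   : Vec ℕ ℓ
    labelSum : sum labels ≡ r

  lv : ℕ
  lv = lvDecomp (decompose dyck) labels

-- The division is exact: see catalan-exact.
catalan : ℕ → ℕ
catalan ℓ = ((2 * ℓ) C ℓ) / suc ℓ

absorb : ∀ n k → suc k * (suc n C suc k) ≡ suc n * (n C k)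
absorb zero zero = refl
absorb zero (suc k)
  rewrite k>n⇒nCk≡0 {1} {suc (suc k)} (s≤s (s≤s z≤n)) | k>n⇒nCk≡0 {0} {suc k} (s≤s z≤n) = *-zeroʳ k
absorb (suc n) zero rewrite nC1≡n (suc (suc n)) = *-comm 1 (suc (suc n))
absorb (suc n) (suc k) = begin
  suc (suc k) * (suc (suc n) C suc (suc k))
    ≡⟨ cong (suc (suc k) *_) (sym (nCk+nC[k+1]≡[n+1]C[k+1] (suc n) (suc k))) ⟩
  suc (suc k) * (x + y)
    ≡⟨ expand k x y ⟩
  x + suc k * x + suc (suc k) * y
    ≡⟨ cong₂ (λ u v → x + u + v) (absorb n k) (absorb n (suc k)) ⟩
  x + suc n * (n C k) + suc n * (n C suc k)
    ≡⟨ collect n x (n C k) (n C suc k) ⟩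
  x + suc n * (n C k + n C suc k)
    ≡⟨ cong (λ u → x + suc n * u) (nCk+nC[k+1]≡[n+1]C[k+1] n k) ⟩
  suc (suc n) * x ∎
  where
  open ≡-Reasoning
  x = suc n C suc k
  y = suc n C suc (suc k)
  expand : ∀ k x y → suc (suc k) * (x + y) ≡ x + suc k * x + suc (suc k) * y
  expand = solve-∀
  collect : ∀ n x u v → x + suc n * u + suc n * v ≡ x + suc n * (u + v)
  collect = solve-∀

catalan-exact : ∀ ℓ → catalan ℓ * suc ℓ ≡ (2 * ℓ) C ℓ
catalan-exact ℓ = m/n*n≡m (∣m+n∣m⇒∣n (divides (2 * c) (sum≡ ℓ c)) (divides s (trans (sym (absorb (2 * ℓ) ℓ)) (*-comm (suc ℓ) s))))
  where
  c = (2 * ℓ) C ℓ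
  s = suc (2 * ℓ) C suc ℓ
  sum≡ : ∀ ℓ c → suc (2 * ℓ) * c + c ≡ 2 * c * suc ℓ
  sum≡ = solve-∀

{-# OPTIONS --safe #-}

-- Cutting a sequence at the last occurrence of its minimum x, as b x c with
-- b ≥ x and c > x, matches the first-return decomposition U π_L D π_R: the
-- initial up step gets the label x, and b - x and c - x - 1 recursively give
-- π_L and π_R. So both sides are labelled binary trees, and the tree of a
-- sequence is built by adding its entries one at a time on the left; each
-- statistic only has to be followed through one such addition.
-- For the count, Dyck paths are enumerated by the ballot numbers
-- C(2u+h, u) - C(2u+h, u-1) and labellings by stars and bars.
module Submission where

open import Defs
open import Data.Bool using (true; false; if_then_else_; _∧_)
open import Data.Bool.Properties using (∧-zeroʳ)
open import Data.Fin using (Fin)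
open import Data.Fin.Properties using (1↔⊤; +↔⊎; *↔×)
open import Data.Integer using (+_; 1ℤ; _-_)
open import Data.List using (List; []; _∷_; _++_; length)
open import Data.List.Properties using (++-assoc; ++-identityʳ; ∷-injectiveʳ)
open import Data.Nat using (ℕ; zero; suc; _+_; _*_; _∸_; _⊓_; _<ᵇ_; _≡ᵇ_; z≤n)
open import Data.Nat.Combinatorics using (_C_; nCk≡nC[n∸k]; nCn≡1; nCk+nC[k+1]≡[n+1]C[k+1])
open import Data.Nat.Properties using (≡-irrelevant; _<?_; +-assoc; +-comm; +-suc; +-identityʳ; +-cancelʳ-≡)
open import Data.Nat.Properties using (*-suc; *-distribʳ-+; *-cancelˡ-≡; *-cancelʳ-≡)
open import Data.Nat.Properties using (m≤m+n; m≤n⇒m≤1+n; m≤n⇒m⊓n≡m; m≥n⇒m⊓n≡n; m+n∸m≡n; m≤n⇒m∸n≡0; [m+n]∸[m+o]≡n∸o)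
open import Data.Nat.Tactic.RingSolver using (solve-∀)
open import Data.Product using (Σ; ∃; ∃₂; _×_; _,_; proj₁; proj₂)
open import Data.Product.Function.NonDependent.Propositional using (_×-↔_)
open import Data.Sum using (_⊎_; inj₁; inj₂)
open import Data.Sum.Function.Propositional using (_⊎-↔_)
open import Data.Unit using (tt)
open import Data.Vec using (Vec; []; _∷_; head; take; drop; sum) renaming (_++_ to _++ᵛ_)
open import Data.Vec.Properties using (take++drop≡id; ++-injective; sum-++)
open import Data.Vec.Relation.Unary.All using (all?)
open import Function.Bundles using (_⤖_; _↔_; mk↔ₛ′; module Bijection)
open import Function.Properties.Inverse using (↔⇒⤖; ↔-sym; ↔-trans)
open import Relation.Binary.PropositionalEquality using (_≡_; refl; sym; trans; cong; cong₂; subst; module ≡-Reasoning)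
open import Relation.Nullary using (does)

private
  variable
    h m n r x : ℕ

-- Sequences as labelled binary trees

data Tree : ℕ → Set where
  leaf : Tree 0
  node : ℕ → Tree m → Tree n → Tree (suc (m + n))

root : Tree (suc n) → ℕ
root (node x _ _) = x

-- `k` is the shifted value: of the old root under `below`, of the new entry under `above`. Equality
-- falls under `above`, since the cut is at the last occurrence of the minimum.
data Position : ℕ → ℕ → Set where
  below : ∀ k → Position x (suc (x + k))
  above : ∀ k → Position (m + k) m

position : ∀ x m → Position x m
position x       zero    = above x
position zero    (suc m) = below m
position (suc x) (suc m) with position x m
... | below k = below k
... | above k = above k

position-below : ∀ x k → position x (suc (x + k)) ≡ below k
position-below zero    k = refl
position-below (suc x) k rewrite position-below x k = refl

position-above : ∀ m k → position (m + k) m ≡ above k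
position-above zero    k = refl
position-above (suc m) k rewrite position-above m k = refl

-- An entry below the root is the new minimum, with nothing before it and the old sequence after it;
-- any other entry joins the part before the last minimum.
prepend : ℕ → Tree n → Tree (suc n)
prepend x leaf = node x leaf leaf
prepend x (node m L R) with position x m
... | below k = node x leaf (node k L R)
... | above k = node m (prepend k L) R

-- Labels are relative to the parent, so a constant added to all entries is felt only at the root.
raise : ℕ → Tree n → Tree n
raise k leaf         = leaf
raise k (node x L R) = node (k + x) L R

-- An empty left subtree means that the last minimum is the first entry itself; otherwise the first
-- entry comes from the left part, shifted by `x`.
unprepend : Tree (suc n) → ℕ × Tree n
unprepend (node {m = zero}  x leaf R) = x , raise (suc x) R
unprepend (node {m = suc _} x L    R) = x + proj₁ (unprepend L) , node x (proj₂ (unprepend L)) R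

first : Tree (suc n) → ℕ
first t = proj₁ (unprepend t)

unprepend-prepend : ∀ x (t : Tree n) → unprepend (prepend x t) ≡ (x , t)
unprepend-prepend x leaf = refl
unprepend-prepend x (node m L R) with position x m
... | below k = refl
... | above k = cong (λ (y , L′) → m + y , node m L′ R) (unprepend-prepend k L)

prepend-unprepend : (t : Tree (suc n)) → prepend (first t) (proj₂ (unprepend t)) ≡ t
prepend-unprepend (node {m = zero} x leaf leaf) = refl
prepend-unprepend (node {m = zero} x leaf (node k L R)) rewrite position-below x k = refl
prepend-unprepend (node {m = suc _} x L R)
  rewrite position-above x (first L) = cong (λ L′ → node x L′ R) (prepend-unprepend L)

toTree : Vec ℕ n → Tree n
toTree []       = leaf
toTree (x ∷ as) = prepend x (toTree as)

toVec : Tree n → Vec ℕ n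
toVec {zero}  leaf = []
toVec {suc n} t    = first t ∷ toVec (proj₂ (unprepend t))

toVec-toTree : (as : Vec ℕ n) → toVec (toTree as) ≡ as
toVec-toTree []       = refl
toVec-toTree (x ∷ as) rewrite unprepend-prepend x (toTree as) = cong (x ∷_) (toVec-toTree as)

toTree-toVec : (t : Tree n) → toTree (toVec t) ≡ t
toTree-toVec {zero}  leaf = refl
toTree-toVec {suc n} t    =
  trans (cong (prepend (first t)) (toTree-toVec (proj₂ (unprepend t)))) (prepend-unprepend t)

first-toTree : ∀ y (as : Vec ℕ n) → first (toTree (y ∷ as)) ≡ y
first-toTree y as = cong proj₁ (unprepend-prepend y (toTree as))

first≡root+ : (t : Tree (suc n)) → ∃ λ e → first t ≡ root t + e
first≡root+ (node {m = zero}  x leaf R) = 0 , sym (+-identityʳ x)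
first≡root+ (node {m = suc _} x L    R) = first L , refl

-- The statistics under adding an entry

-- Preorder is the left-to-right order of the up steps.
labelsOf : Tree n → Vec ℕ n
labelsOf leaf         = []
labelsOf (node x L R) = x ∷ labelsOf L ++ᵛ labelsOf R

total : Tree n → ℕ
total t = sum (labelsOf t)

peaks : Tree n → ℕ
peaks leaf                      = 0
peaks (node {m = zero}  _ _ R) = suc (peaks R)
peaks (node {m = suc _} _ L R) = peaks L + peaks R

returns : Tree n → ℕ
returns leaf         = 0
returns (node _ _ R) = suc (returns R)

-- Kept in the shape of `δ`, with `suc (returns R)` for the number of returns.
primitive₀ : Tree n → ℕ
primitive₀ leaf         = 0
primitive₀ (node x _ R) = if (suc (returns R) ≡ᵇ 1) ∧ (x ≡ᵇ 0) then 1 else 0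

levels : Tree n → ℕ
levels leaf         = 0
levels (node _ L R) = levels L + levels R + primitive₀ L

<ᵇ-cancelˡ : ∀ m k f → (m + k <ᵇ m + f) ≡ (k <ᵇ f)
<ᵇ-cancelˡ zero    k f = refl
<ᵇ-cancelˡ (suc m) k f = <ᵇ-cancelˡ m k f

≡ᵇ-cancelˡ : ∀ m k f → (m + k ≡ᵇ m + f) ≡ (k ≡ᵇ f)
≡ᵇ-cancelˡ zero    k f = refl
≡ᵇ-cancelˡ (suc m) k f = ≡ᵇ-cancelˡ m k f

n<ᵇ1+n+k : ∀ n k → (n <ᵇ suc (n + k)) ≡ true
n<ᵇ1+n+k zero    k = refl
n<ᵇ1+n+k (suc n) k = n<ᵇ1+n+k n k

n≡ᵇ1+n+k : ∀ n k → (n ≡ᵇ suc (n + k)) ≡ false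
n≡ᵇ1+n+k zero    k = refl
n≡ᵇ1+n+k (suc n) k = n≡ᵇ1+n+k n k

n+k<ᵇn : ∀ n k → (n + k <ᵇ n) ≡ false
n+k<ᵇn zero    k = refl
n+k<ᵇn (suc n) k = n+k<ᵇn n k

n+k≡ᵇn : ∀ n k → (n + k ≡ᵇ n) ≡ (k ≡ᵇ 0)
n+k≡ᵇn zero    k = refl
n+k≡ᵇn (suc n) k = n+k≡ᵇn n k

gap : ∀ n k → suc (n + k) ∸ n ∸ 1 ≡ k
gap n k = cong (_∸ 1) (trans (cong (_∸ n) (sym (+-suc n k))) (m+n∸m≡n n (suc k)))

first-below : ∀ x k (L : Tree m) (R : Tree n) →
              ∃ λ e → first (node (suc (x + k)) L R) ≡ suc (x + (k + e))
first-below x k L R with first≡root+ (node (suc (x + k)) L R)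
... | e , eq = e , trans eq (cong suc (+-assoc x k e))

root-prepend : ∀ x (t : Tree (suc n)) → root (prepend x t) ≡ x ⊓ root t
root-prepend x (node m L R) with position x m
... | below k = sym (m≤n⇒m⊓n≡m (m≤n⇒m≤1+n (m≤m+n x k)))
... | above k = sym (m≥n⇒m⊓n≡n (m≤m+n m k))

-- Under `below` the new node has an empty left subtree, hence a peak, and the first entry exceeds
-- `x`. Under `above` with `L` empty, the peak of the root passes to its new left child; with `L`
-- nonempty, the shift cancels in the comparison.
peaks-prepend : ∀ x (t : Tree (suc n)) →
             peaks (prepend x t) ≡ (if x <ᵇ first t then 1 else 0) + peaks t
peaks-prepend x (node m L R) with position x m
peaks-prepend x (node {m = zero} _ leaf R) | below k rewrite n<ᵇ1+n+k x k = refl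
peaks-prepend x (node {m = suc _} _ L R) | below k
  rewrite +-assoc x k (first L) | n<ᵇ1+n+k x (k + first L) = refl
peaks-prepend _ (node {m = zero} m leaf R) | above k rewrite n+k<ᵇn m k = refl
peaks-prepend _ (node {m = suc _} m L R) | above k
  rewrite <ᵇ-cancelˡ m k (first L) | peaks-prepend k L =
  +-assoc (if k <ᵇ first L then 1 else 0) (peaks L) (peaks R)

-- Returns are the nodes of the right spine, which grows exactly when `x` becomes the new root.
returns-prepend : ∀ x (t : Tree (suc n)) →
               returns (prepend x t) ≡ (if x <ᵇ root t then 1 else 0) + returns t
returns-prepend x (node m L R) with position x m
... | below k rewrite n<ᵇ1+n+k x k = refl
... | above k rewrite n+k<ᵇn m k = refl

-- Under `below` both sides vanish: the new tree has a nonempty right subtree, and the old root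
-- label is a successor.
primitive₀-prepend : ∀ x (t : Tree (suc n)) → primitive₀ (prepend x t) ≡ primitive₀ t
primitive₀-prepend x (node m L R) with position x m
... | below k rewrite ∧-zeroʳ (suc (returns R) ≡ᵇ 1) = refl
... | above k = refl

-- A level is created only when an entry enters an empty left subtree: the new left child is
-- primitive with label `k`, and `k` is 0 exactly when `x` equals the old first entry.
levels-prepend : ∀ x (t : Tree (suc n)) →
              levels (prepend x t) ≡ (if x ≡ᵇ first t then 1 else 0) + levels t
levels-prepend x (node m L R) with position x m
levels-prepend x (node {m = zero} _ leaf R) | below k
  rewrite n≡ᵇ1+n+k x k = +-identityʳ _
levels-prepend x (node {m = suc _} _ L R) | below k
  rewrite +-assoc x k (first L) | n≡ᵇ1+n+k x (k + first L) = +-identityʳ _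
levels-prepend _ (node {m = zero} m leaf R) | above k
  rewrite n+k≡ᵇn m k | +-identityʳ (levels R) = +-comm (levels R) _
levels-prepend _ (node {m = suc _} m L R) | above k
  rewrite ≡ᵇ-cancelˡ m k (first L) | levels-prepend k L | primitive₀-prepend k L =
  assoc (if k ≡ᵇ first L then 1 else 0) (levels L) (levels R) (primitive₀ L)
  where
  assoc : ∀ a b c d → a + b + c + d ≡ a + (b + c + d)
  assoc = solve-∀

-- The first entry is moved to the left so that no subtraction of it occurs.
total-prepend : ∀ x (t : Tree (suc n)) →
             total (prepend x t) + first t ≡ x + (first t ∸ x ∸ 1) + total t
total-prepend x (node m L R) with position x m
total-prepend x (node _ L R) | below k with first-below x k L R
... | e , eq rewrite eq | gap x (k + e) = lemma x k e (sum (labelsOf L ++ᵛ labelsOf R))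
  where
  lemma : ∀ x k e s → x + (k + s) + suc (x + (k + e)) ≡ x + (k + e) + suc (x + k + s)
  lemma = solve-∀
-- The first entry is `m`, at most `m + k`, so the truncated jump is 0.
total-prepend _ (node {m = zero} m leaf R) | above k
  rewrite m≤n⇒m∸n≡0 (m≤m+n m k) = lemma m k (total R)
  where
  lemma : ∀ m k s → m + (k + s) + m ≡ m + k + 0 + (m + s)
  lemma = solve-∀
total-prepend _ (node {m = suc _} m L R) | above k
  rewrite [m+n]∸[m+o]≡n∸o m (first L) k | sum-++ {ys = labelsOf R} (labelsOf (prepend k L))
        | sum-++ {ys = labelsOf R} (labelsOf L) = begin
  m + (total (prepend k L) + total R) + (m + first L)
    ≡⟨ collect m (total (prepend k L)) (total R) (first L) ⟩
  m + (total (prepend k L) + first L) + (m + total R)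
    ≡⟨ cong (λ s → m + s + (m + total R)) (total-prepend k L) ⟩
  m + (k + j + total L) + (m + total R)
    ≡⟨ spread m k j (total L) (total R) ⟩
  m + k + j + (m + (total L + total R)) ∎
  where
  open ≡-Reasoning
  j = first L ∸ k ∸ 1
  collect : ∀ m s t f → m + (s + t) + (m + f) ≡ m + (s + f) + (m + t)
  collect = solve-∀
  spread : ∀ m k j s t → m + (k + j + s) + (m + t) ≡ m + k + j + (m + (s + t))
  spread = solve-∀

total-toTree : (as : Vec ℕ n) → total (toTree as) ≡ exc as
total-toTree []           = refl
total-toTree (x ∷ [])     = refl
-- `exc` of the tail counts `y` in full, whereas the longer sequence counts only the jump to `y`;
-- the surplus `y` cancels.
total-toTree (x ∷ y ∷ as) = +-cancelʳ-≡ y _ _ (begin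
  total (prepend x t) + y             ≡⟨ cong (λ f → total (prepend x t) + f) (first-toTree y as) ⟨
  total (prepend x t) + first t       ≡⟨ total-prepend x t ⟩
  x + (first t ∸ x ∸ 1) + total t  ≡⟨ cong₂ (λ f s → x + (f ∸ x ∸ 1) + s) (first-toTree y as) (total-toTree (y ∷ as)) ⟩
  x + (y ∸ x ∸ 1) + (y + J)        ≡⟨ lemma x (y ∸ x ∸ 1) y J ⟩
  x + (y ∸ x ∸ 1 + J) + y          ∎)
  where
  open ≡-Reasoning
  t = toTree (y ∷ as)
  J = jumps (y ∷ as)
  lemma : ∀ x j y J → x + j + (y + J) ≡ x + (j + J) + y
  lemma = solve-∀

peaks-toTree : (as : Vec ℕ (suc n)) → peaks (toTree as) ≡ suc (asc as)
peaks-toTree (x ∷ [])     = refl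
peaks-toTree (x ∷ y ∷ as)
  rewrite peaks-prepend x (toTree (y ∷ as)) | first-toTree y as | peaks-toTree (y ∷ as) = +-suc _ _

levels-toTree : (as : Vec ℕ n) → levels (toTree as) ≡ lev as
levels-toTree []           = refl
levels-toTree (x ∷ [])     = refl
levels-toTree (x ∷ y ∷ as) = trans (levels-prepend x (toTree (y ∷ as)))
  (cong₂ (λ f l → (if x ≡ᵇ f then 1 else 0) + l) (first-toTree y as) (levels-toTree (y ∷ as)))

root-toTree : (as : Vec ℕ (suc n)) → root (toTree as) ≡ minimum as
root-toTree (x ∷ [])     = refl
root-toTree (x ∷ y ∷ as) =
  trans (root-prepend x (toTree (y ∷ as))) (cong (x ⊓_) (root-toTree (y ∷ as)))

<ᵇ-⊓ : ∀ x y z → (x <ᵇ y) ∧ (x <ᵇ z) ≡ (x <ᵇ y ⊓ z)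
<ᵇ-⊓ x       zero    z       = refl
<ᵇ-⊓ x       (suc y) zero    = ∧-zeroʳ (x <ᵇ suc y)
<ᵇ-⊓ zero    (suc y) (suc z) = refl
<ᵇ-⊓ (suc x) (suc y) (suc z) = <ᵇ-⊓ x y z

-- `rlmin` tests all later entries, while the tree only shows their minimum at the root.
all<-minimum : ∀ x (as : Vec ℕ (suc n)) → does (all? (x <?_) as) ≡ (x <ᵇ minimum as)
all<-minimum x (y ∷ [])     with x <ᵇ y
... | true  = refl
... | false = refl
all<-minimum x (y ∷ z ∷ as) =
  trans (cong ((x <ᵇ y) ∧_) (all<-minimum x (z ∷ as))) (<ᵇ-⊓ x y (minimum (z ∷ as)))

returns-toTree : (as : Vec ℕ n) → returns (toTree as) ≡ rlmin as
returns-toTree []           = refl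
returns-toTree (x ∷ [])     = refl
returns-toTree (x ∷ y ∷ as) = trans (returns-prepend x (toTree (y ∷ as)))
  (cong₂ (λ b l → (if b then 1 else 0) + l)
    (trans (cong (x <ᵇ_) (root-toTree (y ∷ as))) (sym (all<-minimum x (y ∷ as))))
    (returns-toTree (y ∷ as)))

-- Labelled trees as labelled Dyck paths

private
  variable
    π π₁ π₂ w w₁ w₂ : List Step

pathOf : Tree n → List Step
pathOf leaf         = []
pathOf (node _ L R) = U ∷ pathOf L ++ D ∷ pathOf R

decompOf : (t : Tree n) → Decomp (pathOf t) n
decompOf leaf         = ε
decompOf (node _ L R) = node (decompOf L) (decompOf R)

label : Decomp π n → Vec ℕ n → Tree n
label ε                    []      = leaf
label (node {m = m} dL dR) (x ∷ v) = node x (label dL (take m v)) (label dR (drop m v))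

pathOf-label : (d : Decomp π n) (v : Vec ℕ n) → pathOf (label d v) ≡ π
pathOf-label ε                    []      = refl
pathOf-label (node {m = m} dL dR) (_ ∷ v) =
  cong₂ (λ πL πR → U ∷ πL ++ D ∷ πR) (pathOf-label dL (take m v)) (pathOf-label dR (drop m v))

labelsOf-label : (d : Decomp π n) (v : Vec ℕ n) → labelsOf (label d v) ≡ v
labelsOf-label ε                    []      = refl
labelsOf-label (node {m = m} dL dR) (x ∷ v) = cong (x ∷_) (trans
  (cong₂ _++ᵛ_ (labelsOf-label dL (take m v)) (labelsOf-label dR (drop m v)))
  (take++drop≡id m v))

take-++ : {A : Set} (v : Vec A m) (v′ : Vec A n) → take m (v ++ᵛ v′) ≡ v
take-++ {m = m} v v′ = proj₁ (++-injective _ v (take++drop≡id m (v ++ᵛ v′)))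

drop-++ : {A : Set} (v : Vec A m) (v′ : Vec A n) → drop m (v ++ᵛ v′) ≡ v′
drop-++ {m = m} v v′ = proj₂ (++-injective _ v (take++drop≡id m (v ++ᵛ v′)))

label-decompOf : (t : Tree n) → label (decompOf t) (labelsOf t) ≡ t
label-decompOf leaf = refl
label-decompOf (node x L R)
  rewrite take-++ (labelsOf L) (labelsOf R) | drop-++ (labelsOf L) (labelsOf R) =
  cong₂ (node x) (label-decompOf L) (label-decompOf R)

-- The end of a Dyck path is marked by a down step below its starting height.
decomp-++D-injective : (d₁ : Decomp π₁ m) (d₂ : Decomp π₂ n) → π₁ ++ D ∷ w₁ ≡ π₂ ++ D ∷ w₂ →
  _≡_ {A = ∃₂ Decomp} (π₁ , m , d₁) (π₂ , n , d₂) × w₁ ≡ w₂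
decomp-++D-injective ε          ε          refl = refl , refl
decomp-++D-injective (node {πL = πL₁} {πR = πR₁} L₁ R₁) (node {πL = πL₂} {πR = πR₂} L₂ R₂) eq
  with decomp-++D-injective L₁ L₂
         (trans (sym (++-assoc πL₁ _ _)) (trans (∷-injectiveʳ eq) (++-assoc πL₂ _ _)))
... | refl , eq′ with decomp-++D-injective R₁ R₂ eq′
...   | refl , eq″ = refl , eq″

-- This allows `decompose` to be replaced by any decomposition at hand, without unfolding its
-- construction through `pieces`.
decomp-irrelevant : (d₁ d₂ : Decomp π n) → d₁ ≡ d₂
decomp-irrelevant d₁ d₂ with decomp-++D-injective {w₁ = []} {w₂ = []} d₁ d₂ refl
... | refl , _ = refl

walk-irrelevant : (p q : Walk h w) → p ≡ q
walk-irrelevant []     []     = refl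
walk-irrelevant (U∷ p) (U∷ q) = cong U∷_ (walk-irrelevant p q)
walk-irrelevant (D∷ p) (D∷ q) = cong D∷_ (walk-irrelevant p q)

isDyck-irrelevant : (p q : IsDyck n π) → p ≡ q
isDyck-irrelevant (isDyck p e) (isDyck q e′) = cong₂ isDyck (walk-irrelevant p q) (≡-irrelevant e e′)

prependWalk : Decomp π n → Walk h w → Walk h (π ++ w)
prependWalk ε p = p
prependWalk (node {πL = πL} L R) p =
  U∷ subst (Walk _) (sym (++-assoc πL _ _)) (prependWalk L (D∷ prependWalk R p))

isDyckOf : (t : Tree n) → IsDyck n (pathOf t)
isDyckOf t = isDyck
  (subst (Walk 0) (++-identityʳ (pathOf t)) (prependWalk (decompOf t) []))
  (decompLength (decompOf t))

decompose-isDyckOf : (t : Tree n) → decompose (isDyckOf t) ≡ decompOf t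
decompose-isDyckOf t = decomp-irrelevant (decompose (isDyckOf t)) (decompOf t)

-- A nonempty Dyck path ends in `D`, so no peak straddles the joint.
pk-pathOf-++ : (t : Tree n) (w : List Step) → pk (pathOf t ++ w) ≡ peaks t + pk w
pk-pathOf-++ leaf w = refl
pk-pathOf-++ (node {m = zero} _ leaf R) w = cong suc (pk-pathOf-++ R w)
-- Exposing the node of `L` shows that the path starts with two up steps, so `pk` skips the first.
pk-pathOf-++ (node {m = suc _} _ L@(node _ _ _) R) w = begin
  pk ((pathOf L ++ D ∷ pathOf R) ++ w)  ≡⟨ cong pk (++-assoc (pathOf L) _ w) ⟩
  pk (pathOf L ++ D ∷ pathOf R ++ w)    ≡⟨ pk-pathOf-++ L _ ⟩
  peaks L + pk (pathOf R ++ w)          ≡⟨ cong (λ s → peaks L + s) (pk-pathOf-++ R w) ⟩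
  peaks L + (peaks R + pk w)            ≡⟨ +-assoc (peaks L) _ _ ⟨
  peaks L + peaks R + pk w              ∎
  where open ≡-Reasoning

pk-pathOf : (t : Tree n) → pk (pathOf t) ≡ peaks t
pk-pathOf t = begin
  pk (pathOf t)        ≡⟨ cong pk (++-identityʳ (pathOf t)) ⟨
  pk (pathOf t ++ [])  ≡⟨ pk-pathOf-++ t [] ⟩
  peaks t + 0          ≡⟨ +-identityʳ _ ⟩
  peaks t              ∎
  where open ≡-Reasoning

-- A Dyck path traversed from positive height never reaches the axis.
retFrom-pathOf-++ : ∀ h (t : Tree n) w → retFrom (suc h) (pathOf t ++ w) ≡ retFrom (suc h) w
retFrom-pathOf-++ h leaf         w = refl
retFrom-pathOf-++ h (node _ L R) w = begin
  retFrom (2 + h) ((pathOf L ++ D ∷ pathOf R) ++ w)  ≡⟨ cong (retFrom (2 + h)) (++-assoc (pathOf L) _ w) ⟩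
  retFrom (2 + h) (pathOf L ++ D ∷ pathOf R ++ w)    ≡⟨ retFrom-pathOf-++ (suc h) L _ ⟩
  retFrom (suc h) (pathOf R ++ w)                    ≡⟨ retFrom-pathOf-++ h R w ⟩
  retFrom (suc h) w                                  ∎
  where open ≡-Reasoning

ret-pathOf : (t : Tree n) → ret (pathOf t) ≡ returns t
ret-pathOf leaf         = refl
ret-pathOf (node _ L R) = trans (retFrom-pathOf-++ 0 L _) (cong suc (ret-pathOf R))

δ-pathOf : (t : Tree n) → δ (pathOf t) (labelsOf t) ≡ primitive₀ t
δ-pathOf leaf           = refl
δ-pathOf t@(node x _ _) = cong (λ s → if (s ≡ᵇ 1) ∧ (x ≡ᵇ 0) then 1 else 0) (ret-pathOf t)

lvDecomp-decompOf : (t : Tree n) → lvDecomp (decompOf t) (labelsOf t) ≡ levels t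
lvDecomp-decompOf leaf = refl
lvDecomp-decompOf (node x L R)
  rewrite take-++ (labelsOf L) (labelsOf R) | drop-++ (labelsOf L) (labelsOf R) =
  cong₂ _+_ (cong₂ _+_ (lvDecomp-decompOf L) (lvDecomp-decompOf R)) (δ-pathOf L)

head-labelsOf : (t : Tree (suc n)) → head (labelsOf t) ≡ root t
head-labelsOf (node _ _ _) = refl

-- The bijection between sequences and labelled paths

𝒜-≡ : {a b : 𝒜 n r} → proj₁ a ≡ proj₁ b → a ≡ b
𝒜-≡ {a = a , e} {b = _ , e′} refl = cong (a ,_) (≡-irrelevant e e′)

𝒟-≡ : {d e : 𝒟 n r} → 𝒟.path d ≡ 𝒟.path e → 𝒟.labels d ≡ 𝒟.labels e → d ≡ e
𝒟-≡ {d = mk𝒟 π p v s} {e = mk𝒟 _ p′ _ s′} refl refl =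
  cong₂ (λ p s → mk𝒟 π p v s) (isDyck-irrelevant p p′) (≡-irrelevant s s′)

𝒜↔𝒟 : 𝒜 n r ↔ 𝒟 n r
𝒜↔𝒟 {n} {r} = mk↔ₛ′ to from to-from from-to
  where
  to : 𝒜 n r → 𝒟 n r
  to (a , e) = mk𝒟 (pathOf t) (isDyckOf t) (labelsOf t) (trans (total-toTree a) e)
    where t = toTree a

  treeOf : 𝒟 n r → Tree n
  treeOf (mk𝒟 _ p v _) = label (decompose p) v

  toTree-treeOf : (d : 𝒟 n r) → toTree (toVec (treeOf d)) ≡ treeOf d
  toTree-treeOf d = toTree-toVec (treeOf d)

  from : 𝒟 n r → 𝒜 n r
  from d@(mk𝒟 _ p v s) = toVec (treeOf d) , (begin
    exc (toVec (treeOf d))             ≡⟨ total-toTree (toVec (treeOf d)) ⟨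
    total (toTree (toVec (treeOf d)))  ≡⟨ cong total (toTree-treeOf d) ⟩
    total (treeOf d)                   ≡⟨ cong sum (labelsOf-label (decompose p) v) ⟩
    sum v                              ≡⟨ s ⟩
    r                                  ∎)
    where open ≡-Reasoning

  to-from : ∀ d → to (from d) ≡ d
  to-from d@(mk𝒟 _ p v _) = 𝒟-≡
    (trans (cong pathOf (toTree-treeOf d)) (pathOf-label (decompose p) v))
    (trans (cong labelsOf (toTree-treeOf d)) (labelsOf-label (decompose p) v))

  from-to : ∀ a → from (to a) ≡ a
  from-to (a , _) = 𝒜-≡ (begin
    toVec (label (decompose (isDyckOf t)) (labelsOf t))
      ≡⟨ cong (λ d → toVec (label d (labelsOf t))) (decompose-isDyckOf t) ⟩
    toVec (label (decompOf t) (labelsOf t))  ≡⟨ cong toVec (label-decompOf t) ⟩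
    toVec t                                  ≡⟨ toVec-toTree a ⟩
    a                                        ∎)
    where
    open ≡-Reasoning
    t = toTree a

-- Counting

-- The number of walks from height `h` to 0 with `u` up steps, by the first step.
ballot : ℕ → ℕ → ℕ
ballot zero    zero    = 1
ballot (suc h) zero    = ballot h zero
ballot zero    (suc u) = ballot 1 u
ballot (suc h) (suc u) = ballot (suc (suc h)) u + ballot h (suc u)

-- n C (k - 1), which is 0 rather than n C 0 for k = 0.
_C⁻_ : ℕ → ℕ → ℕ
n C⁻ zero  = 0
n C⁻ suc k = n C k

nC0≡1 : ∀ n → n C 0 ≡ 1
nC0≡1 n = trans (nCk≡nC[n∸k] {0} {n} z≤n) (nCn≡1 n)

pascal⁻ : ∀ n k → n C⁻ k + n C k ≡ suc n C k
pascal⁻ n zero    = trans (nC0≡1 n) (sym (nC0≡1 (suc n)))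
pascal⁻ n (suc k) = nCk+nC[k+1]≡[n+1]C[k+1] n k

-- Differences of adjacent binomials obey the ballot recurrence by Pascal's rule; the additive form
-- avoids subtraction.
ballot-step : ∀ n k x y → x + n C⁻ k ≡ n C k → y + n C k ≡ n C suc k →
              x + y + suc n C k ≡ suc n C suc k
ballot-step n k x y p q = begin
  x + y + suc n C k               ≡⟨ cong (λ s → x + y + s) (pascal⁻ n k) ⟨
  x + y + (n C⁻ k + n C k)        ≡⟨ lemma x y (n C⁻ k) (n C k) ⟩
  (x + n C⁻ k) + (y + n C k)      ≡⟨ cong₂ _+_ p q ⟩
  n C k + n C suc k               ≡⟨ nCk+nC[k+1]≡[n+1]C[k+1] n k ⟩
  suc n C suc k                   ∎
  where
  open ≡-Reasoning
  lemma : ∀ x y c d → x + y + (c + d) ≡ (x + c) + (y + d)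
  lemma = solve-∀

ballot-formula : ∀ h u → ballot h u + (u + (u + h)) C⁻ u ≡ (u + (u + h)) C u
ballot-formula zero    zero    = refl
ballot-formula (suc h) zero    = begin
  ballot h 0 + 0  ≡⟨ ballot-formula h zero ⟩
  h C 0           ≡⟨ nC0≡1 h ⟩
  1               ≡⟨ nC0≡1 (suc h) ⟨
  suc h C 0       ∎
  where open ≡-Reasoning
ballot-formula zero    (suc u) =
  subst (λ n → ballot 1 u + n C u ≡ n C suc u) (cong suc (cong (λ s → u + s) (+-suc u 0)))
    (trans (cong (_+ suc N C u) (sym (+-identityʳ (ballot 1 u))))
      -- The 0 stands for the missing down step at height 0. It fits the formula because the two
      -- middle binomials of the odd row `N` agree.
      (ballot-step N u (ballot 1 u) 0 (ballot-formula 1 u)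
        (trans (nCk≡nC[n∸k] (m≤m+n u (u + 1))) (cong (N C_) (trans (m+n∸m≡n u (u + 1)) (+-comm u 1))))))
  where N = u + (u + 1)
ballot-formula (suc h) (suc u) =
  subst (λ n → ballot (suc h) (suc u) + n C u ≡ n C suc u) (shift u h)
    (ballot-step N u (ballot (suc (suc h)) u) (ballot h (suc u)) (ballot-formula (suc (suc h)) u)
      (subst (λ n → ballot h (suc u) + n C u ≡ n C suc u) (shift′ u h) (ballot-formula h (suc u))))
  where
  N = u + (u + suc (suc h))
  shift : ∀ u h → suc (u + (u + suc (suc h))) ≡ suc u + (suc u + suc h)
  shift = solve-∀
  shift′ : ∀ u h → suc u + (suc u + h) ≡ u + (u + suc (suc h))
  shift′ = solve-∀

ballot-*-suc : ∀ n → ballot 0 n * suc n ≡ (2 * n) C n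
ballot-*-suc zero    = refl
ballot-*-suc (suc k) = +-cancelʳ-≡ (c * suc (suc k)) _ _ (begin
  b * suc (suc k) + c * suc (suc k)  ≡⟨ *-distribʳ-+ (suc (suc k)) b c ⟨
  (b + c) * suc (suc k)              ≡⟨ cong (_* suc (suc k)) b+c≡d ⟩
  d * suc (suc k)                    ≡⟨ *-suc d (suc k) ⟩
  d + d * suc k                      ≡⟨ cong (λ s → d + s) d*≡c* ⟩
  d + c * suc (suc k)                ∎)
  where
  open ≡-Reasoning
  N = 2 * suc k
  b = ballot 0 (suc k)
  c = N C k
  d = N C suc k
  b+c≡d : b + c ≡ d
  -- `2 * suc k` unfolds to `suc k + (suc k + 0)`.
  b+c≡d = ballot-formula 0 (suc k)
  -- The ratio of consecutive binomials in row `N`, obtained from `absorb` and Pascal's rule.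
  d*≡c* : d * suc k ≡ c * suc (suc k)
  d*≡c* = +-cancelʳ-≡ (c * suc k) _ _ (begin
    d * suc k + c * suc k            ≡⟨ collect k c d ⟩
    suc k * (c + d)                  ≡⟨ cong (suc k *_) (nCk+nC[k+1]≡[n+1]C[k+1] N k) ⟩
    suc k * (suc N C suc k)          ≡⟨ absorb N k ⟩
    suc N * c                        ≡⟨ spread k c ⟩
    c * suc (suc k) + c * suc k      ∎)
    where
    collect : ∀ k c d → d * suc k + c * suc k ≡ suc k * (c + d)
    collect = solve-∀
    spread : ∀ k c → suc (2 * suc k) * c ≡ c * suc (suc k) + c * suc k
    spread = solve-∀

ballot≡catalan : ∀ n → ballot 0 n ≡ catalan n
ballot≡catalan n = *-cancelʳ-≡ _ _ (suc n) (trans (ballot-*-suc n) (sym (catalan-exact n)))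

-- Enumeration of walks and Dyck paths

ups : List Step → ℕ
ups []      = 0
ups (U ∷ w) = suc (ups w)
ups (D ∷ w) = ups w

length-walk : Walk h w → length w ≡ h + 2 * ups w
length-walk []                     = refl
length-walk {h} {w = U ∷ w} (U∷ p) = trans (cong suc (length-walk p)) (lemma h (ups w))
  where
  lemma : ∀ h u → suc (suc h + 2 * u) ≡ h + 2 * suc u
  lemma = solve-∀
length-walk (D∷ p)                 = cong suc (length-walk p)

Walks : ℕ → ℕ → Set
Walks h u = ∃ λ w → Walk h w × ups w ≡ u

-- Removing the first step mirrors the clauses of `ballot`.
walks↔Fin : ∀ h u → Walks h u ↔ Fin (ballot h u)
walks↔Fin zero zero = ↔-trans
  (mk↔ₛ′ (λ _ → tt) (λ _ → [] , [] , refl) (λ _ → refl) (λ { (_ , [] , refl) → refl }))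
  (↔-sym 1↔⊤)
walks↔Fin (suc h) zero = ↔-trans
  (mk↔ₛ′ (λ { (_ , D∷ p , e) → _ , p , e }) (λ { (_ , p , e) → _ , D∷ p , e })
         (λ _ → refl) (λ { (_ , D∷ p , e) → refl }))
  (walks↔Fin h zero)
walks↔Fin zero (suc u) = ↔-trans
  (mk↔ₛ′ (λ { (_ , U∷ p , refl) → _ , p , refl }) (λ { (_ , p , refl) → _ , U∷ p , refl })
         (λ { (_ , p , refl) → refl }) (λ { (_ , U∷ p , refl) → refl }))
  (walks↔Fin 1 u)
walks↔Fin (suc h) (suc u) = ↔-trans
  (mk↔ₛ′ to from
         (λ { (inj₁ (_ , p , refl)) → refl ; (inj₂ _) → refl })
         (λ { (_ , U∷ p , refl) → refl ; (_ , D∷ p , e) → refl }))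
  (↔-trans (walks↔Fin (suc (suc h)) u ⊎-↔ walks↔Fin h (suc u)) (↔-sym +↔⊎))
  where
  to : Walks (suc h) (suc u) → Walks (suc (suc h)) u ⊎ Walks h (suc u)
  to (_ , U∷ p , refl) = inj₁ (_ , p , refl)
  to (_ , D∷ p , e)    = inj₂ (_ , p , e)
  from : Walks (suc (suc h)) u ⊎ Walks h (suc u) → Walks (suc h) (suc u)
  from (inj₁ (_ , p , refl)) = _ , U∷ p , refl
  from (inj₂ (_ , p , e))    = _ , D∷ p , e

dyck↔walks : ∃ (IsDyck n) ↔ Walks 0 n
dyck↔walks {n} = mk↔ₛ′
  (λ (w , isDyck p e) → w , p , *-cancelˡ-≡ (ups w) n 2 (trans (sym (length-walk p)) e))
  (λ (w , p , e) → w , isDyck p (trans (length-walk p) (cong (2 *_) e)))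
  (λ (w , p , e) → cong (λ e → w , p , e) (≡-irrelevant _ e))
  (λ (w , isDyck p e) → cong (λ e → w , isDyck p e) (≡-irrelevant _ e))

dyck↔Fin : ∀ n → ∃ (IsDyck n) ↔ Fin (catalan n)
dyck↔Fin n = subst (λ c → ∃ (IsDyck n) ↔ Fin c) (ballot≡catalan n)
  (↔-trans dyck↔walks (walks↔Fin 0 n))

-- Stars and bars for labellings

Labelling : ℕ → ℕ → Set
Labelling n r = Σ (Vec ℕ n) λ v → sum v ≡ r

-- A first label 0 is dropped and a positive one is lowered by 1; the two cases add up by Pascal's
-- rule.
labelling↔Fin : ∀ m r → Labelling (suc m) r ↔ Fin ((r + m) C m)
labelling↔Fin zero r = subst (λ c → Labelling 1 r ↔ Fin c) (sym (nC0≡1 (r + 0))) (↔-trans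
  (mk↔ₛ′ (λ _ → tt) (λ _ → r ∷ [] , +-identityʳ r) (λ _ → refl) unique)
  (↔-sym 1↔⊤))
  where
  unique : (l : Labelling 1 r) → (r ∷ [] , +-identityʳ r) ≡ l
  unique (x ∷ [] , e) with trans (sym (+-identityʳ x)) e
  ... | refl = cong (x ∷ [] ,_) (≡-irrelevant _ e)
labelling↔Fin (suc m) zero =
  subst (λ c → Labelling (suc (suc m)) 0 ↔ Fin c) (trans (nCn≡1 m) (sym (nCn≡1 (suc m)))) (↔-trans
  (mk↔ₛ′ to (λ (v , e) → zero ∷ v , e)
         (λ _ → refl) (λ { (zero ∷ v , e) → refl ; (suc _ ∷ _ , ()) }))
  (labelling↔Fin m zero))
  where
  to : Labelling (suc (suc m)) 0 → Labelling (suc m) 0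
  to (zero ∷ v , e) = v , e
labelling↔Fin (suc m) (suc r) =
  subst (λ c → Labelling (suc (suc m)) (suc r) ↔ Fin c)
    (trans (cong (λ n → n C m + (r + suc m) C suc m) (sym (+-suc r m)))
           (nCk+nC[k+1]≡[n+1]C[k+1] (r + suc m) m))
    (↔-trans (mk↔ₛ′ to from
         (λ { (inj₁ _) → refl ; (inj₂ (_ ∷ _ , refl)) → refl })
         (λ { (zero ∷ v , e) → refl ; (suc x ∷ v , refl) → refl }))
      (↔-trans (labelling↔Fin m (suc r) ⊎-↔ labelling↔Fin (suc m) r) (↔-sym +↔⊎)))
  where
  to : Labelling (suc (suc m)) (suc r) → Labelling (suc m) (suc r) ⊎ Labelling (suc (suc m)) r
  to (zero ∷ v , e)     = inj₁ (v , e)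
  to (suc x ∷ v , refl) = inj₂ (x ∷ v , refl)
  from : Labelling (suc m) (suc r) ⊎ Labelling (suc (suc m)) r → Labelling (suc (suc m)) (suc r)
  from (inj₁ (v , e))        = zero ∷ v , e
  from (inj₂ (x ∷ v , refl)) = suc x ∷ v , refl

𝒟↔dyck×labelling : 𝒟 n r ↔ (∃ (IsDyck n) × Labelling n r)
𝒟↔dyck×labelling = mk↔ₛ′
  (λ (mk𝒟 π p v s) → (π , p) , (v , s))
  (λ ((π , p) , (v , s)) → mk𝒟 π p v s)
  (λ _ → refl) (λ _ → refl)

𝒟↔Fin : ∀ m r → 𝒟 (suc m) r ↔ Fin (catalan (suc m) * ((r + m) C m))
𝒟↔Fin m r = ↔-trans 𝒟↔dyck×labelling
  (↔-trans (dyck↔Fin (suc m) ×-↔ labelling↔Fin m r) (↔-sym *↔×))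

lemma3p1 : (m r : ℕ) → let ℓ = suc m in
    (Σ (𝒜 ℓ r ⤖ 𝒟 ℓ r) λ Φ →
    (a : 𝒜 ℓ r) → let d = Bijection.to Φ a in
    (+ asc (proj₁ a) ≡ + pk (𝒟.path d) - 1ℤ)
    × (lev (proj₁ a) ≡ 𝒟.lv d)
    × (rlmin (proj₁ a) ≡ ret (𝒟.path d))
    × (head (𝒟.labels d) ≡ minimum (proj₁ a)))
    × (𝒜 ℓ r ⤖ Fin (catalan ℓ * ((r + ℓ ∸ 1) C (ℓ ∸ 1))))
lemma3p1 m r =
  (↔⇒⤖ 𝒜↔𝒟 , λ (a , _) →
      -- The left side is `+ suc (asc a) - 1ℤ`, which computes to `+ asc a`.
      cong (λ k → + k - 1ℤ) (sym (trans (pk-pathOf (toTree a)) (peaks-toTree a)))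
    , sym (trans (cong (λ d → lvDecomp d (labelsOf (toTree a))) (decompose-isDyckOf (toTree a)))
                 (trans (lvDecomp-decompOf (toTree a)) (levels-toTree a)))
    , sym (trans (ret-pathOf (toTree a)) (returns-toTree a))
    , trans (head-labelsOf (toTree a)) (root-toTree a))
  -- Identifies `r + m` with `r + ℓ ∸ 1` for `ℓ = suc m`.
  , subst (λ n → 𝒜 (suc m) r ⤖ Fin (catalan (suc m) * (n C m))) (cong (_∸ 1) (sym (+-suc r m)))
      (↔⇒⤖ (↔-trans 𝒜↔𝒟 (𝒟↔Fin m r)))
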